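{- Let $\mathcal{L}$ be one of the logics $L5$, $EL5$, $L5^{AC^- }_N$, $L5^{AC}_N$. For every set of formulas $\Phi\cup\{\varphi\}$ of the object language of $\mathcal{L}$: $\Phi\vdash_{\mathcal{L}}\varphi$ implies $\Phi\Vdash_{\mathcal{L}}\varphi$.
   Context: **Languages.** $I=\{1,\dots,N\}$, $N\ge 1$, is a fixed finite set of agents; a group is a non-empty $G\subseteq I$. The full set of formulas $Fm$ is built from an infinite set of propositional variables $V=\{x_0,x_1,\dots\}$ and $\bot$ using $\vee,\wedge,\rightarrow$, and unary operators $\square$, $K_i$ ($i\in I$), $C_G$ ($G$ a group). Abbreviations: $\neg\varphi:=(\varphi\rightarrow\bot)$, $\top:=(\bot\rightarrow\bot)$. The languages of $L5^{AC^- }_N$ and $L5^{AC}_N$ are $Fm$; the language of $L5$ has only the operator $\square$; the language of $EL5$ has only $\square$ and a single $K$. **Axiom schemes.** (INT) all formulas having the form of a theorem of intuitionistic propositional logic; (i) $\square(\varphi\vee\psi)\rightarrow(\square\varphi\vee\square\psi)$; (ii) $\square\varphi\rightarrow\varphi$; (iii) $\square(\varphi\rightarrow\psi)\rightarrow(\square\varphi\rightarrow\square\psi)$; (iv) $\square\varphi\rightarrow\square\square\varphi$; (v) $\neg\square\varphi\rightarrow\square\neg\square\varphi$; (vi) $K_i\varphi\rightarrow\varphi$; (vii) $K_i(\varphi\rightarrow\psi)\rightarrow(K_i\varphi\rightarrow K_i\psi)$; (viii) $K_i(\varphi\vee\psi)\rightarrow(K_i\varphi\vee K_i\psi)$; (ix)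 $C_G(\varphi\rightarrow\psi)\rightarrow(C_G\varphi\rightarrow C_G\psi)$; (x) $C_G(\varphi\vee\psi)\rightarrow(C_G\varphi\vee C_G\psi)$; (xi) $\square\varphi\rightarrow\square C_G\varphi$; (xii) $C_G\varphi\rightarrow K_i\varphi$ for $i\in G$; (xiii) $C_G\varphi\rightarrow C_GK_i\varphi$ for $i\in G$; (xiv) $C_G\varphi\rightarrow C_{G'}\varphi$ for non-empty $G'\subseteq G$; (xv) $C_G\varphi\rightarrow C_GC_G\varphi$; (TND) $\varphi\vee\neg\varphi$. **Logics.** $L5$: (INT), (i)--(v), (TND). $EL5$: the axioms of $L5$ plus $K\varphi\rightarrow\neg\neg\varphi$, $K(\varphi\rightarrow\psi)\rightarrow(K\varphi\rightarrow K\psi)$, $\square\varphi\rightarrow\square K\varphi$. $L5^{AC}_N$: all of (INT), (i)--(xv), (TND). $L5^{AC^- }_N$: as $L5^{AC}_N$ but without (x) and (xv). Inference rules of each logic: Modus Ponens (MP), and (AN): if $\varphi$ is an axiom of the logic other than an instance of (TND), infer $\square\varphi$. $\Phi\vdash_{\mathcal{L}}\varphi$ means there is a finite sequence ending in $\varphi$ each member of which is an axiom, an element of $\Phi$, or obtained from earlier members by (MP) or (AN) (with (AN) applied only to axioms other than (TND)). **Models.** A Heyting algebra is written $(M,f_\vee,f_\wedge,f_\bot,f_\rightarrow)$ with order $\le$; $f_\top:=f_\rightarrow(f_\bot,f_\bot)$, $f_\neg(m):=f_\rightarrow(m,f_\bot)$. A filter is $F\subseteq M$ with $f_\top\in F$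 such that $m\in F$ and $f_\rightarrow(m,m')\in F$ imply $m'\in F$; it is proper if $f_\bot\notin F$; prime if proper and $f_\vee(m,m')\in F$ implies $m\in F$ or $m'\in F$; an ultrafilter is a maximal proper filter. A *model* is a structure $\mathcal{M}=(M,\mathit{TRUE},f_\vee,f_\wedge,f_\bot,f_\rightarrow,f_\square,(f_{K_i})_{i\in I},(f_{C_G})_{\varnothing\ne G\subseteq I})$ consisting of a Heyting algebra, an ultrafilter $\mathit{TRUE}\subseteq M$, and unary operations $f_\square,f_{K_i},f_{C_G}$ on $M$, such that: (i) (Disjunction Property) $f_\vee(m,m')=f_\top$ implies $m=f_\top$ or $m'=f_\top$, i.e. the smallest filter $\{f_\top\}$ is prime; (ii) $f_\square(m)=f_\top$ if $m=f_\top$, and $f_\square(m)=f_\bot$ otherwise; (iii) for every prime filter $F$, all $i\in I$ and all groups $G$: (a) $\mathit{BEL}_i(F):=\{m\mid f_{K_i}(m)\in F\}$ is a filter; (b) $\mathit{COMMON}_G(F):=\{m\mid f_{C_G}(m)\in F\}$ is a filter; (c) $\mathit{BEL}_i(F)\subseteq U$ for every ultrafilter $U\supseteq F$; (d) $\mathit{COMMON}_G(F)\subseteq\mathit{BEL}_i(F)$ whenever $i\in G$; (e) $m\in\mathit{COMMON}_G(F)$ implies $f_{K_i}(m)\in\mathit{COMMON}_G(F)$ whenever $i\in G$; (f) $\mathit{COMMON}_G(F)\subseteq\mathit{COMMON}_{G'}(F)$ whenever $\varnothing\ne G'\subseteq G$. An $L5^{AC^- }_N$-*model* is a model satisfying,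 instead of (iii)(c), the stronger condition (c)*: for every prime filter $F$ and $i\in I$, $\mathit{BEL}_i(F)$ is a prime filter and $\mathit{BEL}_i(F)\subseteq F$. An $L5^{AC}_N$-*model* is a model satisfying (c)* such that for every prime filter $F$ and group $G$, $\mathit{COMMON}_G(F)$ is a prime filter and (g): $m\in\mathit{COMMON}_G(F)$ implies $f_{C_G}(m)\in\mathit{COMMON}_G(F)$. An $EL5$-*model* is a Heyting algebra with an ultrafilter $\mathit{TRUE}$ and unary operations $f_\square$, $f_K$ satisfying (i), (ii), (iii)(a), (iii)(c) (single agent, no common knowledge). An $L5$-*model* is a Heyting algebra with an ultrafilter $\mathit{TRUE}$ and a unary operation $f_\square$ satisfying (i), (ii). **Satisfaction and consequence.** An assignment $\gamma:V\to M$ extends homomorphically to all formulas ($\bot\mapsto f_\bot$, connectives and operators interpreted by the corresponding operations). For an $\mathcal{L}$-model $\mathcal{M}$, $(\mathcal{M},\gamma)\vDash_{\mathcal{L}}\varphi$ iff $\gamma(\varphi)\in\mathit{TRUE}$. $\Phi\Vdash_{\mathcal{L}}\varphi$ means: for every $\mathcal{L}$-model $\mathcal{M}$ and assignment $\gamma$, if $(\mathcal{M},\gamma)\vDash_{\mathcal{L}}\psi$ for all $\psi\in\Phi$, then $(\mathcal{M},\gamma)\vDash_{\mathcal{L}}\varphi$. -}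

module Defs where

open import Agda.Primitive using (Setω)
open import Level using (Level; _⊔_) renaming (suc to lsuc)
open import Data.Empty using (⊥)
open import Data.Fin.Base using (Fin)
open import Data.Fin.Subset as Subset using (Subset; Nonempty)
open import Data.List.Base using (List; []; _∷_)
open import Data.List.Membership.Propositional using () renaming (_∈_ to _∈ˡ_)
open import Data.Nat.Base using (ℕ; NonZero)
open import Data.Product.Base using (∃)
open import Data.Sum.Base using (_⊎_)
open import Relation.Binary.Bundles using (Poset)
open import Relation.Binary.Definitions using (_Respects_)
open import Relation.Binary.Lattice.Bundles using (HeytingAlgebra)
open import Relation.Nullary.Negation.Core using (¬_)
open import Relation.Unary using (Pred; _∈_; _⊆_)

private
  variable
    c ℓ₁ ℓ₂ p ℓ : Level

-- Every chain, the empty one included, is required to have an upper bound.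
-- Together with excluded middle this is the classical set theory in which
-- prime filters and ultrafilters are obtained.
ZornsLemma : ∀ c ℓ₁ ℓ₂ p → Set (lsuc (c ⊔ ℓ₁ ⊔ ℓ₂ ⊔ p))
ZornsLemma c ℓ₁ ℓ₂ p =
  (P : Poset c ℓ₁ ℓ₂) → let open Poset P in
  ((C : Pred Carrier p) →
     (∀ {x y} → x ∈ C → y ∈ C → x ≤ y ⊎ y ≤ x) →
     ∃ λ u → ∀ {x} → x ∈ C → x ≤ u) →
  ∃ λ m → ∀ {x} → m ≤ x → x ≈ m

infix  9 _·_
infix  8 ¬̇_
infixr 7 _∧̇_
infixr 6 _∨̇_
infixr 5 _⇒_

data Formula (Op : Set) : Set where
  var            : ℕ → Formula Op
  ⊥̇              : Formula Op
  _∨̇_ _∧̇_ _⇒_    : Formula Op → Formula Op → Formula Op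
  _·_            : Op → Formula Op → Formula Op

¬̇_ : ∀ {Op} → Formula Op → Formula Op
¬̇ φ = φ ⇒ ⊥̇

-- Non-emptiness is irrelevant so that a group, and hence the operator C_G,
-- is determined by its set of members.
record Group (N : ℕ) : Set where
  field
    members   : Subset N
    .nonempty : Nonempty members

open Group public

infix 4 _∈ᴳ_ _⊆ᴳ_

_∈ᴳ_ : ∀ {N} → Fin N → Group N → Set
i ∈ᴳ G = i Subset.∈ members G

_⊆ᴳ_ : ∀ {N} → Group N → Group N → Set
G ⊆ᴳ H = members G Subset.⊆ members H

data Language : Set where
  modal     : Language
  epistemic : Language
  common    : ℕ → Language

data Op : Language → Set where
  □ᵒ : ∀ {L} → Op L
  Kᵒ : Op epistemic
  Kᵢ : ∀ {N} → Fin N → Op (common N)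
  Cᵒ : ∀ {N} → Group N → Op (common N)

Fm : Language → Set
Fm L = Formula (Op L)

infix 8 □_

□_ : ∀ {L} → Fm L → Fm L
□ φ = □ᵒ · φ

K : Fm epistemic → Fm epistemic
K φ = Kᵒ · φ

K[_] : ∀ {N} → Fin N → Fm (common N) → Fm (common N)
K[ i ] φ = Kᵢ i · φ

C[_] : ∀ {N} → Group N → Fm (common N) → Fm (common N)
C[ G ] φ = Cᵒ G · φ

PropFm : Set
PropFm = Formula ⊥

infix 3 ⊢ᴵ_

data ⊢ᴵ_ : PropFm → Set where
  ax-k  : ∀ {α β}   → ⊢ᴵ α ⇒ β ⇒ α
  ax-s  : ∀ {α β δ} → ⊢ᴵ (α ⇒ β ⇒ δ) ⇒ (α ⇒ β) ⇒ α ⇒ δ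
  ∧-fst : ∀ {α β}   → ⊢ᴵ α ∧̇ β ⇒ α
  ∧-snd : ∀ {α β}   → ⊢ᴵ α ∧̇ β ⇒ β
  ∧-int : ∀ {α β}   → ⊢ᴵ α ⇒ β ⇒ α ∧̇ β
  ∨-inl : ∀ {α β}   → ⊢ᴵ α ⇒ α ∨̇ β
  ∨-inr : ∀ {α β}   → ⊢ᴵ β ⇒ α ∨̇ β
  ∨-elm : ∀ {α β δ} → ⊢ᴵ (α ⇒ δ) ⇒ (β ⇒ δ) ⇒ α ∨̇ β ⇒ δ
  ⊥-elm : ∀ {α}     → ⊢ᴵ ⊥̇ ⇒ α
  mp    : ∀ {α β}   → ⊢ᴵ α → ⊢ᴵ α ⇒ β → ⊢ᴵ β

_[_] : ∀ {Op} → PropFm → (ℕ → Formula Op) → Formula Op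
var n   [ σ ] = σ n
⊥̇       [ σ ] = ⊥̇
(α ∨̇ β) [ σ ] = (α [ σ ]) ∨̇ (β [ σ ])
(α ∧̇ β) [ σ ] = (α [ σ ]) ∧̇ (β [ σ ])
(α ⇒ β) [ σ ] = (α [ σ ]) ⇒ (β [ σ ])

-- The axiom schemes other than tertium non datur, i.e. those to which
-- axiom necessitation applies, are kept apart from the latter.

data L5Scheme {L : Language} : Fm L → Set where
  int  : ∀ {α} → ⊢ᴵ α → (σ : ℕ → Fm L) → L5Scheme (α [ σ ])
  □-∨  : ∀ φ ψ → L5Scheme (□ (φ ∨̇ ψ) ⇒ □ φ ∨̇ □ ψ)
  □-T  : ∀ φ   → L5Scheme (□ φ ⇒ φ)
  □-⇒  : ∀ φ ψ → L5Scheme (□ (φ ⇒ ψ) ⇒ □ φ ⇒ □ ψ)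
  □-4  : ∀ φ   → L5Scheme (□ φ ⇒ □ □ φ)
  □-5  : ∀ φ   → L5Scheme (¬̇ □ φ ⇒ □ ¬̇ □ φ)

data EL5Scheme : Fm epistemic → Set where
  l5   : ∀ {φ} → L5Scheme φ → EL5Scheme φ
  K-¬¬ : ∀ φ   → EL5Scheme (K φ ⇒ ¬̇ ¬̇ φ)
  K-⇒  : ∀ φ ψ → EL5Scheme (K (φ ⇒ ψ) ⇒ K φ ⇒ K ψ)
  □-K  : ∀ φ   → EL5Scheme (□ φ ⇒ □ K φ)

data L5AC⁻Scheme {N : ℕ} : Fm (common N) → Set where
  l5   : ∀ {φ} → L5Scheme φ → L5AC⁻Scheme φ
  K-T  : ∀ i φ   → L5AC⁻Scheme (K[ i ] φ ⇒ φ)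
  K-⇒  : ∀ i φ ψ → L5AC⁻Scheme (K[ i ] (φ ⇒ ψ) ⇒ K[ i ] φ ⇒ K[ i ] ψ)
  K-∨  : ∀ i φ ψ → L5AC⁻Scheme (K[ i ] (φ ∨̇ ψ) ⇒ K[ i ] φ ∨̇ K[ i ] ψ)
  C-⇒  : ∀ G φ ψ → L5AC⁻Scheme (C[ G ] (φ ⇒ ψ) ⇒ C[ G ] φ ⇒ C[ G ] ψ)
  □-C  : ∀ G φ   → L5AC⁻Scheme (□ φ ⇒ □ C[ G ] φ)
  C-K  : ∀ {G i} → i ∈ᴳ G → ∀ φ → L5AC⁻Scheme (C[ G ] φ ⇒ K[ i ] φ)
  C-CK : ∀ {G i} → i ∈ᴳ G → ∀ φ → L5AC⁻Scheme (C[ G ] φ ⇒ C[ G ] (K[ i ] φ))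
  C-⊆  : ∀ {G G′} → G′ ⊆ᴳ G → ∀ φ → L5AC⁻Scheme (C[ G ] φ ⇒ C[ G′ ] φ)

data L5ACScheme {N : ℕ} : Fm (common N) → Set where
  l5ac⁻ : ∀ {φ} → L5AC⁻Scheme φ → L5ACScheme φ
  C-∨   : ∀ G φ ψ → L5ACScheme (C[ G ] (φ ∨̇ ψ) ⇒ C[ G ] φ ∨̇ C[ G ] ψ)
  C-4   : ∀ G φ   → L5ACScheme (C[ G ] φ ⇒ C[ G ] (C[ G ] φ))

data Logic : Set where
  L5 EL5     : Logic
  L5AC⁻ L5AC : (N : ℕ) .{{_ : NonZero N}} → Logic

language : Logic → Language
language L5        = modal
language EL5       = epistemic
language (L5AC⁻ N) = common N
language (L5AC N)  = common N

Necessitable : ∀ 𝓛 → Fm (language 𝓛) → Set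
Necessitable L5        = L5Scheme
Necessitable EL5       = EL5Scheme
Necessitable (L5AC⁻ N) = L5AC⁻Scheme
Necessitable (L5AC N)  = L5ACScheme

data Axiom (𝓛 : Logic) : Fm (language 𝓛) → Set where
  nec : ∀ {φ} → Necessitable 𝓛 φ → Axiom 𝓛 φ
  tnd : ∀ φ → Axiom 𝓛 (φ ∨̇ ¬̇ φ)

module _ (𝓛 : Logic) (Φ : Pred (Fm (language 𝓛)) ℓ) where

  data Justified (earlier : List (Fm (language 𝓛))) : Fm (language 𝓛) → Set ℓ where
    axm : ∀ {φ} → Axiom 𝓛 φ → Justified earlier φ
    hyp : ∀ {φ} → φ ∈ Φ → Justified earlier φ
    MP  : ∀ {φ ψ} → φ ∈ˡ earlier → (φ ⇒ ψ) ∈ˡ earlier → Justified earlier ψ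
    AN  : ∀ {φ} → φ ∈ˡ earlier → Necessitable 𝓛 φ → Justified earlier (□ φ)

  -- Derivations are listed with the most recent formula first.
  data Derivation : List (Fm (language 𝓛)) → Set ℓ where
    []  : Derivation []
    _∷_ : ∀ {φ φs} → Justified φs φ → Derivation φs → Derivation (φ ∷ φs)


Derivable : (𝓛 : Logic) → Pred (Fm (language 𝓛)) ℓ → Fm (language 𝓛) → Set ℓ
Derivable 𝓛 Φ φ = ∃ λ φs → Derivation 𝓛 Φ (φ ∷ φs)

infix 3 Derivable
syntax Derivable 𝓛 Φ φ = Φ ⊢[ 𝓛 ] φ

-- Subsets of the (setoid) carrier are predicates respecting _≈_; library ⊤ is
-- the element ⊥ ⇨ ⊥.
module _ (H : HeytingAlgebra c ℓ₁ ℓ₂) where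
  open HeytingAlgebra H renaming (⊥ to ⊥ᴴ)

  record IsFilter (F : Pred Carrier p) : Set (c ⊔ ℓ₁ ⊔ p) where
    field
      resp-≈ : F Respects _≈_
      ⊤∈     : ⊤ ∈ F
      detach : ∀ {m m′} → m ∈ F → (m ⇨ m′) ∈ F → m′ ∈ F

  record IsProperFilter (F : Pred Carrier p) : Set (c ⊔ ℓ₁ ⊔ p) where
    field
      isFilter : IsFilter F
      ⊥∉       : ¬ (⊥ᴴ ∈ F)
    open IsFilter isFilter public

  record IsPrimeFilter (F : Pred Carrier p) : Set (c ⊔ ℓ₁ ⊔ p) where
    field
      isProperFilter : IsProperFilter F
      prime          : ∀ {m m′} → (m ∨ m′) ∈ F → m ∈ F ⊎ m′ ∈ F
    open IsProperFilter isProperFilter public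

  record IsUltrafilter (F : Pred Carrier p) : Set (c ⊔ ℓ₁ ⊔ lsuc p) where
    field
      isProperFilter : IsProperFilter F
      maximal        : (F′ : Pred Carrier p) → IsProperFilter F′ → F ⊆ F′ → F′ ⊆ F
    open IsProperFilter isProperFilter public

record Structure (L : Language) (c ℓ₁ ℓ₂ p : Level)
                 : Set (lsuc (c ⊔ ℓ₁ ⊔ ℓ₂ ⊔ p)) where
  field
    heytingAlgebra : HeytingAlgebra c ℓ₁ ℓ₂
  open HeytingAlgebra heytingAlgebra public
  field
    TRUE               : Pred Carrier p
    TRUE-isUltrafilter : IsUltrafilter heytingAlgebra TRUE
    f                  : Op L → Carrier → Carrier
    f-cong             : ∀ o {m m′} → m ≈ m′ → f o m ≈ f o m′

  Filter PrimeFilter Ultrafilter : Pred Carrier p → Set _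
  Filter      = IsFilter heytingAlgebra
  PrimeFilter = IsPrimeFilter heytingAlgebra
  Ultrafilter = IsUltrafilter heytingAlgebra

  -- Specialises to BEL for the operator K and to COMMON for the operator C.
  preimage : Op L → Pred Carrier p → Pred Carrier p
  preimage o F m = f o m ∈ F

record IsL5Model {L} (S : Structure L c ℓ₁ ℓ₂ p) : Set (c ⊔ ℓ₁ ⊔ lsuc p) where
  open Structure S renaming (⊥ to ⊥ᴴ)
  field
    disjunction : ∀ {m m′} → m ∨ m′ ≈ ⊤ → m ≈ ⊤ ⊎ m′ ≈ ⊤
    □-⊤         : ∀ {m} → m ≈ ⊤ → f □ᵒ m ≈ ⊤
    □-⊥         : ∀ {m} → ¬ (m ≈ ⊤) → f □ᵒ m ≈ ⊥ᴴ

record IsEL5Model (S : Structure epistemic c ℓ₁ ℓ₂ p) : Set (c ⊔ ℓ₁ ⊔ lsuc p) where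
  open Structure S
  BEL : Pred Carrier p → Pred Carrier p
  BEL = preimage Kᵒ
  field
    isL5Model  : IsL5Model S
    BEL-filter : ∀ F → PrimeFilter F → Filter (BEL F)
    BEL-ultra  : ∀ F → PrimeFilter F → ∀ U → Ultrafilter U → F ⊆ U → BEL F ⊆ U

record IsL5AC⁻Model {N} (S : Structure (common N) c ℓ₁ ℓ₂ p)
                    : Set (c ⊔ ℓ₁ ⊔ lsuc p) where
  open Structure S
  BEL : Fin N → Pred Carrier p → Pred Carrier p
  BEL i = preimage (Kᵢ i)
  COMMON : Group N → Pred Carrier p → Pred Carrier p
  COMMON G = preimage (Cᵒ G)
  -- That BEL i F is a filter and is contained in every ultrafilter above F is
  -- subsumed by BEL-prime and BEL-⊆.
  field
    isL5Model     : IsL5Model S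
    BEL-prime     : ∀ F → PrimeFilter F → ∀ i → PrimeFilter (BEL i F)
    BEL-⊆         : ∀ F → PrimeFilter F → ∀ i → BEL i F ⊆ F
    COMMON-filter : ∀ F → PrimeFilter F → ∀ G → Filter (COMMON G F)
    COMMON-BEL    : ∀ F → PrimeFilter F → ∀ G i → i ∈ᴳ G → COMMON G F ⊆ BEL i F
    COMMON-K      : ∀ F → PrimeFilter F → ∀ G i → i ∈ᴳ G →
                    ∀ {m} → m ∈ COMMON G F → f (Kᵢ i) m ∈ COMMON G F
    COMMON-⊆      : ∀ F → PrimeFilter F → ∀ G G′ → G′ ⊆ᴳ G → COMMON G F ⊆ COMMON G′ F

record IsL5ACModel {N} (S : Structure (common N) c ℓ₁ ℓ₂ p)
                   : Set (c ⊔ ℓ₁ ⊔ lsuc p) where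
  open Structure S
  field
    isL5AC⁻Model : IsL5AC⁻Model S
  open IsL5AC⁻Model isL5AC⁻Model public
  field
    COMMON-prime : ∀ F → PrimeFilter F → ∀ G → PrimeFilter (COMMON G F)
    COMMON-C     : ∀ F → PrimeFilter F → ∀ G →
                   ∀ {m} → m ∈ COMMON G F → f (Cᵒ G) m ∈ COMMON G F

IsModel : ∀ 𝓛 → Structure (language 𝓛) c ℓ₁ ℓ₂ p → Set (c ⊔ ℓ₁ ⊔ lsuc p)
IsModel L5        = IsL5Model
IsModel EL5       = IsEL5Model
IsModel (L5AC⁻ N) = IsL5AC⁻Model
IsModel (L5AC N)  = IsL5ACModel

record Model (𝓛 : Logic) (c ℓ₁ ℓ₂ p : Level) : Set (lsuc (c ⊔ ℓ₁ ⊔ ℓ₂ ⊔ p)) where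
  field
    structure : Structure (language 𝓛) c ℓ₁ ℓ₂ p
    isModel   : IsModel 𝓛 structure
  open Structure structure public

module _ {L} (S : Structure L c ℓ₁ ℓ₂ p) where
  open Structure S renaming (⊥ to ⊥ᴴ)

  ⟦_⟧ : Fm L → (ℕ → Carrier) → Carrier
  ⟦ var n ⟧ γ = γ n
  ⟦ ⊥̇ ⟧     γ = ⊥ᴴ
  ⟦ φ ∨̇ ψ ⟧ γ = ⟦ φ ⟧ γ ∨ ⟦ ψ ⟧ γ
  ⟦ φ ∧̇ ψ ⟧ γ = ⟦ φ ⟧ γ ∧ ⟦ ψ ⟧ γ
  ⟦ φ ⇒ ψ ⟧ γ = ⟦ φ ⟧ γ ⇨ ⟦ ψ ⟧ γ
  ⟦ o · φ ⟧ γ = f o (⟦ φ ⟧ γ)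

Satisfies : ∀ {𝓛} (𝓜 : Model 𝓛 c ℓ₁ ℓ₂ p) → (ℕ → Model.Carrier 𝓜) → Fm (language 𝓛) → Set p
Satisfies 𝓜 γ φ = ⟦_⟧ (Model.structure 𝓜) φ γ ∈ Model.TRUE 𝓜

infix 3 Satisfies
syntax Satisfies 𝓜 γ φ = 𝓜 , γ ⊨ φ

Consequence : (𝓛 : Logic) → Pred (Fm (language 𝓛)) ℓ → Fm (language 𝓛) → Setω
Consequence 𝓛 Φ φ =
  ∀ {c ℓ₁ ℓ₂ p} (𝓜 : Model 𝓛 c ℓ₁ ℓ₂ p) (γ : ℕ → Model.Carrier 𝓜) →
  (∀ {ψ} → ψ ∈ Φ → 𝓜 , γ ⊨ ψ) → 𝓜 , γ ⊨ φ

infix 3 Consequence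
syntax Consequence 𝓛 Φ φ = Φ ⊩[ 𝓛 ] φ

{-# OPTIONS --safe #-}

-- Axioms other than tertium non datur denote the top element, so that □ of
-- them does too; tertium non datur only holds because TRUE is an ultrafilter.
-- By the prime filter theorem an inequality m ≤ m′ may be checked on prime
-- filters, which turns the model conditions into the axioms for K and C. For
-- Kφ → ¬¬φ in EL5, a prime filter containing Kφ and ¬φ is extended to an
-- ultrafilter, which would contain both φ and ¬φ.
module Submission where

open import Defs
open import Axiom.ExcludedMiddle using (ExcludedMiddle)
open import Data.List.Relation.Unary.All using (All; []; _∷_; head; lookup)
open import Data.Product.Base using (Σ-syntax; ∃-syntax; _×_; _,_; proj₁; proj₂)
open import Data.Sum.Base as Sum using (_⊎_; inj₁; inj₂; [_,_]′)
open import Data.Empty using (⊥-elim)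
open import Data.Nat.Base using (ℕ)
open import Function.Base using (_∘_)
open import Level using (Level; Lift; lift; lower; _⊔_) renaming (suc to lsuc)
open import Relation.Binary.Bundles using (Poset)
import Relation.Binary.Construct.On as On
open import Relation.Binary.Lattice.Bundles using (HeytingAlgebra)
open import Relation.Nullary.Decidable.Core
  using (yes; no; True; toWitness; fromWitness; decidable-stable)
open import Relation.Nullary.Negation.Core using (¬_; contradiction)
open import Relation.Unary using (Pred; _∈_; _∉_; _⊆_)
open import Relation.Unary.Relation.Binary.Subset using (⊆-poset)
import Relation.Binary.Lattice.Properties.HeytingAlgebra as HeytingProperties

private
  variable
    c ℓ₁ ℓ₂ p q ℓ : Level

-- Filters of a Heyting algebra.

module FilterProperties (H : HeytingAlgebra c ℓ₁ ℓ₂) where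
  open HeytingAlgebra H renaming (⊥ to ⊥ᴴ)
  open HeytingProperties H

  ≤⇒⊤≤⇨ : ∀ {x y} → x ≤ y → ⊤ ≤ x ⇨ y
  ≤⇒⊤≤⇨ x≤y = transpose-⇨ (trans (x∧y≤y _ _) x≤y)

  ≤-detach : ∀ {w x y} → w ≤ x → w ≤ x ⇨ y → w ≤ y
  ≤-detach w≤x w≤x⇨y = trans (∧-greatest w≤x⇨y w≤x) ⇨-eval

  ⊤≤⇒≈⊤ : ∀ {x} → ⊤ ≤ x → x ≈ ⊤
  ⊤≤⇒≈⊤ = antisym (maximum _)

  upward : ∀ {F : Pred Carrier p} → IsFilter H F → ∀ {x y} → x ≤ y → x ∈ F → y ∈ F
  upward filter x≤y x∈F = detach x∈F (resp-≈ (Eq.sym (⊤≤⇒≈⊤ (≤⇒⊤≤⇨ x≤y))) ⊤∈)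
    where open IsFilter filter

  ∧-closed : ∀ {F : Pred Carrier p} → IsFilter H F → ∀ {x y} → x ∈ F → y ∈ F → x ∧ y ∈ F
  ∧-closed filter x∈F y∈F =
    IsFilter.detach filter y∈F (upward filter (transpose-⇨ refl) x∈F)

  -- For a filter `F` this is the filter generated by `F` and `a`.
  adjoin : Pred Carrier p → Carrier → Pred Carrier p
  adjoin F a x = a ⇨ x ∈ F

  adjoin-isFilter : ∀ {F : Pred Carrier p} → IsFilter H F → ∀ a → IsFilter H (adjoin F a)
  adjoin-isFilter filter a = record
    { resp-≈ = λ x≈y → resp-≈ (⇨-cong Eq.refl x≈y)
    ; ⊤∈     = upward filter y≤x⇨y ⊤∈
    ; detach = λ a⇨m a⇨m⇨m′ → upward filter
        (transpose-⇨ (≤-detach (transpose-∧ (x∧y≤x _ _)) (transpose-∧ (x∧y≤y _ _))))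
        (∧-closed filter a⇨m a⇨m⇨m′)
    }
    where open IsFilter filter

  -- A single notion serves two purposes: `b = ⊥ᴴ` gives the ultrafilters, and arbitrary `b` gives
  -- the prime filters that separate elements.
  record MaximalAvoiding (b : Carrier) (F : Pred Carrier p) : Set (c ⊔ ℓ₁ ⊔ lsuc p) where
    field
      isFilter : IsFilter H F
      avoids   : b ∉ F
      maximal  : (F′ : Pred Carrier p) → IsFilter H F′ → b ∉ F′ → F ⊆ F′ → F′ ⊆ F

  maximalAvoiding-⊥⇒ultra : ∀ {F : Pred Carrier p} → MaximalAvoiding ⊥ᴴ F → IsUltrafilter H F
  maximalAvoiding-⊥⇒ultra max = record
    { isProperFilter = record { isFilter = isFilter ; ⊥∉ = avoids }
    ; maximal        = λ F′ proper → maximal F′ (IsProperFilter.isFilter proper) (IsProperFilter.⊥∉ proper)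
    }
    where open MaximalAvoiding max

  ultra⇒maximalAvoiding-⊥ : ∀ {F : Pred Carrier p} → IsUltrafilter H F → MaximalAvoiding ⊥ᴴ F
  ultra⇒maximalAvoiding-⊥ ultra = record
    { isFilter = isFilter
    ; avoids   = ⊥∉
    ; maximal  = λ F′ filter ⊥∉F′ → maximal F′ (record { isFilter = filter ; ⊥∉ = ⊥∉F′ })
    }
    where open IsUltrafilter ultra

-- Prime filters and ultrafilters from excluded middle and Zorn's lemma.

module Classical (em : ∀ {ℓ} → ExcludedMiddle ℓ) where

  -- Excluded middle makes every proposition equivalent to one at any given
  -- level, so filters defined by quantifying over filters stay at level p.
  Resize : ∀ p → Set q → Set p
  Resize p P = Lift p (True (em {P = P}))

  resize : {P : Set q} → P → Resize p P
  resize = lift ∘ fromWitness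

  unresize : {P : Set q} → Resize p P → P
  unresize = toWitness ∘ lower

  module PrimeFilters (H : HeytingAlgebra c ℓ₁ ℓ₂) where
    open HeytingAlgebra H renaming (⊥ to ⊥ᴴ)
    open HeytingProperties H
    open FilterProperties H

    module _ {b : Carrier} {F : Pred Carrier p} (max : MaximalAvoiding b F) where
      open MaximalAvoiding max

      -- If `x ⇨ b` were outside `F`, the filter generated by `F` and `x` would still avoid `b`, so
      -- by maximality `x` would already lie in `F`.
      ∉⇒⇨∈ : ∀ {x} → x ∉ F → x ⇨ b ∈ F
      ∉⇒⇨∈ {x} x∉F = decidable-stable em λ x⇨b∉F → x∉F
        (maximal (adjoin F x) (adjoin-isFilter isFilter x) x⇨b∉F (upward isFilter y≤x⇨y)
          (IsFilter.resp-≈ isFilter (Eq.sym ⇨-unit) (IsFilter.⊤∈ isFilter)))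

      -- If neither `x` nor `y` is in `F`, then `F` contains `x ⇨ b` and `y ⇨ b`, hence
      -- `(x ∨ y) ⇨ b`; with `x ∨ y` in `F` this would force `b` into `F`.
      maximalAvoiding⇒prime : IsPrimeFilter H F
      maximalAvoiding⇒prime = record
        { isProperFilter = record
          { isFilter = isFilter
          ; ⊥∉       = avoids ∘ upward isFilter (minimum b)
          }
        ; prime = prime
        }
        where
        prime : ∀ {x y} → x ∨ y ∈ F → x ∈ F ⊎ y ∈ F
        prime {x} {y} x∨y∈F with em {P = x ∈ F} | em {P = y ∈ F}
        ... | yes x∈F | _       = inj₁ x∈F
        ... | no _    | yes y∈F = inj₂ y∈F
        ... | no x∉F  | no y∉F  = contradiction
          (IsFilter.detach isFilter x∨y∈F
            (upward isFilter (⇨-distribˡ-∨-∧-≥ x y b)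
              (∧-closed isFilter (∉⇒⇨∈ x∉F) (∉⇒⇨∈ y∉F))))
          avoids

    ultra-complete : ∀ {U : Pred Carrier p} → IsUltrafilter H U → ∀ x → x ∨ (x ⇨ ⊥ᴴ) ∈ U
    ultra-complete {U = U} ultra x with em {P = x ∈ U}
    ... | yes x∈U = upward (IsUltrafilter.isFilter ultra) (x≤x∨y _ _) x∈U
    ... | no  x∉U = upward (IsUltrafilter.isFilter ultra) (y≤x∨y _ _)
                      (∉⇒⇨∈ (ultra⇒maximalAvoiding-⊥ ultra) x∉U)

    module _ (zorn : ∀ {c ℓ₁ ℓ₂ p} → ZornsLemma c ℓ₁ ℓ₂ p) where

      -- Zorn's lemma is applied to the filters that contain `F₀` and avoid `b`, ordered by
      -- inclusion.
      extend-maximalAvoiding : ∀ {F₀ : Pred Carrier p} {b} → IsFilter H F₀ → b ∉ F₀ →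
                               ∃[ F ] MaximalAvoiding b F × F₀ ⊆ F
      extend-maximalAvoiding {p = p} {F₀} {b} filter₀ b∉F₀ =
        let (F , filter , b∉F , F₀⊆F) , max = zorn {p = p} poset′ chain-bound in
        F , record
          { isFilter = filter
          ; avoids   = b∉F
          ; maximal  = λ F′ filter′ b∉F′ F⊆F′ →
              -- Equality in the poset is mutual inclusion, and its first half is `F′ ⊆ F`.
              proj₁ (max {F′ , filter′ , b∉F′ , λ {_} m∈F₀ → F⊆F′ (F₀⊆F m∈F₀)} F⊆F′)
          } , F₀⊆F
        where
        Extension : Set _
        Extension = Σ[ F ∈ Pred Carrier p ] IsFilter H F × b ∉ F × F₀ ⊆ F

        poset′ : Poset _ _ _
        poset′ = On.poset (⊆-poset Carrier p) (proj₁ {B = λ F → IsFilter H F × b ∉ F × F₀ ⊆ F})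

        chain-bound : (C : Pred Extension p) →
          (∀ {x y} → x ∈ C → y ∈ C → proj₁ x ⊆ proj₁ y ⊎ proj₁ y ⊆ proj₁ x) →
          ∃[ u ] (∀ {x} → x ∈ C → proj₁ x ⊆ proj₁ u)
        chain-bound C chain =
          (⋃C , ⋃C-isFilter , b∉⋃C , λ {_} m∈F₀ → resize (inj₁ m∈F₀)) ,
          λ {E} E∈C {_} m∈E → resize (inj₂ (E , E∈C , m∈E))
          where
          -- F₀ is added for the sake of the empty chain.
          ⋃C : Pred Carrier p
          ⋃C m = Resize p (m ∈ F₀ ⊎ ∃[ E ] E ∈ C × m ∈ proj₁ E)

          b∉⋃C : b ∉ ⋃C
          b∉⋃C = [ b∉F₀ , (λ { ((_ , _ , b∉F , _) , _ , b∈F) → b∉F b∈F }) ]′ ∘ unresize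

          ⋃C-isFilter : IsFilter H ⋃C
          ⋃C-isFilter = record
            { resp-≈ = λ x≈y → resize ∘
                Sum.map (IsFilter.resp-≈ filter₀ x≈y)
                  (λ { (E , E∈C , x∈E) → E , E∈C , IsFilter.resp-≈ (proj₁ (proj₂ E)) x≈y x∈E })
                ∘ unresize
            ; ⊤∈     = resize (inj₁ (IsFilter.⊤∈ filter₀))
            ; detach = λ x∈⋃ x⇨y∈⋃ → resize (detach′ (unresize x∈⋃) (unresize x⇨y∈⋃))
            }
            where
            detach-in : ∀ E → E ∈ C → ∀ {x y} → x ∈ proj₁ E → x ⇨ y ∈ proj₁ E →
                        y ∈ F₀ ⊎ ∃[ E ] E ∈ C × y ∈ proj₁ E
            detach-in E E∈C x∈E x⇨y∈E = inj₂ (E , E∈C , IsFilter.detach (proj₁ (proj₂ E)) x∈E x⇨y∈E)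

            detach′ : ∀ {x y} →
                      x ∈ F₀ ⊎ (∃[ E ] E ∈ C × x ∈ proj₁ E) →
                      x ⇨ y ∈ F₀ ⊎ (∃[ E ] E ∈ C × x ⇨ y ∈ proj₁ E) →
                      y ∈ F₀ ⊎ (∃[ E ] E ∈ C × y ∈ proj₁ E)
            detach′ (inj₁ x∈F₀) (inj₁ x⇨y∈F₀) = inj₁ (IsFilter.detach filter₀ x∈F₀ x⇨y∈F₀)
            detach′ (inj₁ x∈F₀) (inj₂ (E@(_ , _ , _ , F₀⊆E) , E∈C , x⇨y∈E)) =
              detach-in E E∈C (F₀⊆E x∈F₀) x⇨y∈E
            detach′ (inj₂ (E@(_ , _ , _ , F₀⊆E) , E∈C , x∈E)) (inj₁ x⇨y∈F₀) =
              detach-in E E∈C x∈E (F₀⊆E x⇨y∈F₀)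
            -- The larger of the two chain members contains both premises.
            detach′ (inj₂ (D , D∈C , x∈D)) (inj₂ (E , E∈C , x⇨y∈E)) with chain D∈C E∈C
            ... | inj₁ D⊆E = detach-in E E∈C (D⊆E x∈D) x⇨y∈E
            ... | inj₂ E⊆D = detach-in D D∈C x∈D (E⊆D x⇨y∈E)

      extend-ultra : ∀ {F : Pred Carrier p} → IsProperFilter H F →
                     ∃[ U ] IsUltrafilter H U × F ⊆ U
      extend-ultra proper =
        let U , max , F⊆U = extend-maximalAvoiding (IsProperFilter.isFilter proper) (IsProperFilter.⊥∉ proper)
        in U , maximalAvoiding-⊥⇒ultra max , F⊆U

      -- If `x ≰ y`, the principal filter of `x` avoids `y`; a maximal such extension is prime and
      -- separates the two. The level `p` is that of the prime filters quantified over, and the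
      -- principal filter is resized to it.
      primes-determine-≤ : ∀ p {x y} →
        (∀ (F : Pred Carrier p) → IsPrimeFilter H F → x ∈ F → y ∈ F) → x ≤ y
      primes-determine-≤ p {x} {y} x∈⇒y∈ = decidable-stable em λ x≰y →
        let F , max , ↑x⊆F = extend-maximalAvoiding ↑x-isFilter (x≰y ∘ unresize)
        in MaximalAvoiding.avoids max
             (x∈⇒y∈ F (maximalAvoiding⇒prime max) (↑x⊆F (resize refl)))
        where
        ↑x : Pred Carrier p
        ↑x m = Resize p (x ≤ m)

        ↑x-isFilter : IsFilter H ↑x
        ↑x-isFilter = record
          { resp-≈ = λ m≈m′ x≤m → resize (trans (unresize x≤m) (reflexive m≈m′))
          ; ⊤∈     = resize (maximum x)
          ; detach = λ x≤m x≤m⇨m′ → resize (≤-detach (unresize x≤m) (unresize x≤m⇨m′))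
          }

  -- Validity of the intuitionistic and L5 schemes, and inequalities for the other operators.

  module Validity (zorn : ∀ {c ℓ₁ ℓ₂ p} → ZornsLemma c ℓ₁ ℓ₂ p)
                  {L : Language} (S : Structure L c ℓ₁ ℓ₂ p) where
    open Structure S renaming (⊥ to ⊥ᴴ)
    open HeytingProperties heytingAlgebra hiding (¬_)
    open FilterProperties heytingAlgebra
    open PrimeFilters heytingAlgebra

    Valid : Pred (Fm L) _
    Valid φ = ∀ γ → ⊤ ≤ ⟦_⟧ S φ γ

    int-valid : ∀ {α} → ⊢ᴵ α → ∀ σ → Valid (α [ σ ])
    int-valid ax-k σ γ = ≤⇒⊤≤⇨ y≤x⇨y
    int-valid ax-s σ γ = ≤⇒⊤≤⇨ (transpose-⇨ (transpose-⇨
      (≤-detach (transpose-∧ (x∧y≤y _ _)) (≤-detach (x∧y≤y _ _) (trans (x∧y≤x _ _) (x∧y≤x _ _))))))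
    int-valid ∧-fst σ γ = ≤⇒⊤≤⇨ (x∧y≤x _ _)
    int-valid ∧-snd σ γ = ≤⇒⊤≤⇨ (x∧y≤y _ _)
    int-valid ∧-int σ γ = ≤⇒⊤≤⇨ (transpose-⇨ refl)
    int-valid ∨-inl σ γ = ≤⇒⊤≤⇨ (x≤x∨y _ _)
    int-valid ∨-inr σ γ = ≤⇒⊤≤⇨ (y≤x∨y _ _)
    int-valid ∨-elm σ γ = ≤⇒⊤≤⇨ (transpose-⇨ (⇨-distribˡ-∨-∧-≥ _ _ _))
    int-valid ⊥-elm σ γ = ≤⇒⊤≤⇨ (minimum _)
    int-valid (mp ⊢α ⊢α⇒β) σ γ = ≤-detach (int-valid ⊢α σ γ) (int-valid ⊢α⇒β σ γ)

    module _ (isL5 : IsL5Model S) where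
      open IsL5Model isL5

      ⊤≤□ : ∀ {x} → x ≈ ⊤ → ∀ {w} → w ≤ f □ᵒ x
      ⊤≤□ x≈⊤ = trans (maximum _) (reflexive (Eq.sym (□-⊤ x≈⊤)))

      -- The value of `f □ᵒ` is always top or bottom, and bottom lies below everything, so only
      -- `x ≈ ⊤` remains to be checked.
      □-≤ : ∀ {x y} → (x ≈ ⊤ → ⊤ ≤ y) → f □ᵒ x ≤ y
      □-≤ {x} x≈⊤⇒⊤≤y with em {P = x ≈ ⊤}
      ... | yes x≈⊤ = trans (maximum _) (x≈⊤⇒⊤≤y x≈⊤)
      ... | no  x≉⊤ = trans (reflexive (□-⊥ x≉⊤)) (minimum _)

      ¬□-≤ : ∀ {x y} → (¬ (x ≈ ⊤) → ⊤ ≤ y) → f □ᵒ x ⇨ ⊥ᴴ ≤ y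
      ¬□-≤ {x} x≉⊤⇒⊤≤y with em {P = x ≈ ⊤}
      ... | yes x≈⊤ = trans (≤-detach (⊤≤□ x≈⊤) refl) (minimum _)
      ... | no  x≉⊤ = trans (maximum _) (x≉⊤⇒⊤≤y x≉⊤)

      L5-valid : ∀ {φ} → L5Scheme φ → Valid φ
      L5-valid (int ⊢α σ) γ = int-valid ⊢α σ γ
      L5-valid (□-∨ φ ψ) γ  = ≤⇒⊤≤⇨ (□-≤ λ x∨y≈⊤ →
        [ (λ x≈⊤ → trans (⊤≤□ x≈⊤) (x≤x∨y _ _)) , (λ y≈⊤ → trans (⊤≤□ y≈⊤) (y≤x∨y _ _)) ]′
          (disjunction x∨y≈⊤))
      L5-valid (□-T φ) γ    = ≤⇒⊤≤⇨ (□-≤ λ x≈⊤ → reflexive (Eq.sym x≈⊤))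
      L5-valid (□-⇒ φ ψ) γ  = ≤⇒⊤≤⇨ (□-≤ λ x⇨y≈⊤ → ≤⇒⊤≤⇨ (□-≤ λ x≈⊤ →
        ⊤≤□ (⊤≤⇒≈⊤ (≤-detach (reflexive (Eq.sym x≈⊤)) (reflexive (Eq.sym x⇨y≈⊤))))))
      L5-valid (□-4 φ) γ    = ≤⇒⊤≤⇨ (□-≤ λ x≈⊤ → ⊤≤□ (□-⊤ x≈⊤))
      -- When `x` is not top, `f □ᵒ x` is bottom, so its negation is top and is kept there by
      -- `f □ᵒ`.
      L5-valid (□-5 φ) γ    = ≤⇒⊤≤⇨ (¬□-≤ λ x≉⊤ →
        ⊤≤□ (⊤≤⇒≈⊤ (≤⇒⊤≤⇨ (reflexive (□-⊥ x≉⊤)))))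

    module _ {o : Op L} (filter : ∀ F → PrimeFilter F → Filter (preimage o F)) where

      normal-≤ : ∀ {x y} → f o (x ⇨ y) ≤ f o x ⇨ f o y
      normal-≤ = transpose-⇨ (primes-determine-≤ zorn p λ F prime ∈F →
        let up = upward (IsPrimeFilter.isFilter prime) in
        IsFilter.detach (filter F prime) (up (x∧y≤y _ _) ∈F) (up (x∧y≤x _ _) ∈F))

      -- Every preimage filter contains top, so `f o ⊤` lies in all prime filters and is itself top.
      □-≤-□∘ : IsL5Model S → ∀ {x} → f □ᵒ x ≤ f □ᵒ (f o x)
      □-≤-□∘ isL5 = □-≤ isL5 λ x≈⊤ → ⊤≤□ isL5 (⊤≤⇒≈⊤ (primes-determine-≤ zorn p λ F prime _ →
        IsFilter.resp-≈ (filter F prime) (Eq.sym x≈⊤) (IsFilter.⊤∈ (filter F prime))))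

    ∨-preserving-≤ : ∀ {o} → (∀ F → PrimeFilter F → PrimeFilter (preimage o F)) →
                     ∀ {x y} → f o (x ∨ y) ≤ f o x ∨ f o y
    ∨-preserving-≤ prime-preimage = primes-determine-≤ zorn p λ F prime ∈F →
      let up = upward (IsPrimeFilter.isFilter prime) in
      [ up (x≤x∨y _ _) , up (y≤x∨y _ _) ]′ (IsPrimeFilter.prime (prime-preimage F prime) ∈F)

  -- Validity of the epistemic and common knowledge schemes.

  module _ (zorn : ∀ {c ℓ₁ ℓ₂ p} → ZornsLemma c ℓ₁ ℓ₂ p) where

    module _ (S : Structure epistemic c ℓ₁ ℓ₂ p) (isEL5 : IsEL5Model S) where
      open Structure S
      open FilterProperties heytingAlgebra
      open PrimeFilters heytingAlgebra
      open Validity zorn S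
      open IsEL5Model isEL5

      EL5-valid : ∀ {φ} → EL5Scheme φ → Valid φ
      EL5-valid (l5 s) γ      = L5-valid isL5Model s γ
      -- After transposition the goal is that no prime filter contains the meet of the values of
      -- `K φ` and `¬̇ φ`.
      EL5-valid (K-¬¬ φ) γ    = ≤⇒⊤≤⇨ (transpose-⇨ (primes-determine-≤ zorn p λ F prime ∈F →
        let up              = upward (IsPrimeFilter.isFilter prime)
            U , ultra , F⊆U = extend-ultra zorn (IsPrimeFilter.isProperFilter prime)
        in ⊥-elim (IsUltrafilter.⊥∉ ultra (IsUltrafilter.detach ultra
             (BEL-ultra F prime U ultra F⊆U (up (x∧y≤x _ _) ∈F))
             (F⊆U (up (x∧y≤y _ _) ∈F))))))
      EL5-valid (K-⇒ φ ψ) γ = ≤⇒⊤≤⇨ (normal-≤ BEL-filter)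
      EL5-valid (□-K φ) γ   = ≤⇒⊤≤⇨ (□-≤-□∘ BEL-filter isL5Model)

    module _ {N} (S : Structure (common N) c ℓ₁ ℓ₂ p) (isL5AC⁻ : IsL5AC⁻Model S) where
      open Structure S
      open FilterProperties heytingAlgebra
      open PrimeFilters heytingAlgebra
      open Validity zorn S
      open IsL5AC⁻Model isL5AC⁻

      -- An inclusion between preimages that holds for all prime filters is, by
      -- `primes-determine-≤`, an inequality between the operators.
      L5AC⁻-valid : ∀ {φ} → L5AC⁻Scheme φ → Valid φ
      L5AC⁻-valid (l5 s) γ      = L5-valid isL5Model s γ
      L5AC⁻-valid (K-T i φ) γ   = ≤⇒⊤≤⇨ (primes-determine-≤ zorn p λ F prime → BEL-⊆ F prime i)
      L5AC⁻-valid (K-⇒ i φ ψ) γ =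
        ≤⇒⊤≤⇨ (normal-≤ λ F prime → IsPrimeFilter.isFilter (BEL-prime F prime i))
      L5AC⁻-valid (K-∨ i φ ψ) γ = ≤⇒⊤≤⇨ (∨-preserving-≤ λ F prime → BEL-prime F prime i)
      L5AC⁻-valid (C-⇒ G φ ψ) γ = ≤⇒⊤≤⇨ (normal-≤ λ F prime → COMMON-filter F prime G)
      L5AC⁻-valid (□-C G φ) γ   =
        ≤⇒⊤≤⇨ (□-≤-□∘ (λ F prime → COMMON-filter F prime G) isL5Model)
      L5AC⁻-valid (C-K i∈G φ) γ =
        ≤⇒⊤≤⇨ (primes-determine-≤ zorn p λ F prime → COMMON-BEL F prime _ _ i∈G)
      L5AC⁻-valid (C-CK i∈G φ) γ =
        ≤⇒⊤≤⇨ (primes-determine-≤ zorn p λ F prime → COMMON-K F prime _ _ i∈G)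
      L5AC⁻-valid (C-⊆ {G} {G′} G′⊆G φ) γ =
        ≤⇒⊤≤⇨ (primes-determine-≤ zorn p λ F prime → COMMON-⊆ F prime G G′ G′⊆G)

    module _ {N} (S : Structure (common N) c ℓ₁ ℓ₂ p) (isL5AC : IsL5ACModel S) where
      open Structure S
      open FilterProperties heytingAlgebra
      open PrimeFilters heytingAlgebra
      open Validity zorn S
      open IsL5ACModel isL5AC

      L5AC-valid : ∀ {φ} → L5ACScheme φ → Valid φ
      L5AC-valid (l5ac⁻ s) γ   = L5AC⁻-valid S isL5AC⁻Model s γ
      L5AC-valid (C-∨ G φ ψ) γ = ≤⇒⊤≤⇨ (∨-preserving-≤ λ F prime → COMMON-prime F prime G)
      L5AC-valid (C-4 G φ) γ   =
        ≤⇒⊤≤⇨ (primes-determine-≤ zorn p λ F prime → COMMON-C F prime G)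

    necessitable-valid : ∀ 𝓛 (S : Structure (language 𝓛) c ℓ₁ ℓ₂ p) → IsModel 𝓛 S →
                         ∀ {φ} → Necessitable 𝓛 φ → Validity.Valid zorn S φ
    necessitable-valid L5        S isModel = Validity.L5-valid zorn S isModel
    necessitable-valid EL5       S isModel = EL5-valid S isModel
    necessitable-valid (L5AC⁻ N) S isModel = L5AC⁻-valid S isModel
    necessitable-valid (L5AC N)  S isModel = L5AC-valid S isModel

    isModel⇒isL5Model : ∀ 𝓛 (S : Structure (language 𝓛) c ℓ₁ ℓ₂ p) → IsModel 𝓛 S → IsL5Model S
    isModel⇒isL5Model L5        S isModel = isModel
    isModel⇒isL5Model EL5       S isModel = IsEL5Model.isL5Model isModel
    isModel⇒isL5Model (L5AC⁻ N) S isModel = IsL5AC⁻Model.isL5Model isModel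
    isModel⇒isL5Model (L5AC N)  S isModel = IsL5ACModel.isL5Model isModel

    -- Soundness along derivations.

    module _ (𝓛 : Logic) (Φ : Pred (Fm (language 𝓛)) ℓ) (𝓜 : Model 𝓛 c ℓ₁ ℓ₂ p)
             (γ : ℕ → Model.Carrier 𝓜) (⊨Φ : ∀ {ψ} → ψ ∈ Φ → 𝓜 , γ ⊨ ψ) where
      open Model 𝓜
      open FilterProperties heytingAlgebra
      open IsUltrafilter TRUE-isUltrafilter

      ⊤≤⇒TRUE : ∀ {x} → ⊤ ≤ x → x ∈ TRUE
      ⊤≤⇒TRUE ⊤≤x = upward isFilter ⊤≤x ⊤∈

      valid : ∀ {φ} → Necessitable 𝓛 φ → ⊤ ≤ ⟦_⟧ structure φ γ
      valid s = necessitable-valid 𝓛 structure isModel s γ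

      justified-sound : ∀ {φs φ} → Justified 𝓛 Φ φs φ → All (Satisfies 𝓜 γ) φs → 𝓜 , γ ⊨ φ
      justified-sound (axm (nec s))  _ = ⊤≤⇒TRUE (valid s)
      justified-sound (axm (tnd φ))  _ =
        PrimeFilters.ultra-complete heytingAlgebra TRUE-isUltrafilter (⟦_⟧ structure φ γ)
      justified-sound (hyp φ∈Φ)      _ = ⊨Φ φ∈Φ
      justified-sound (MP φ∈ φ⇒ψ∈) ⊨φs = detach (lookup ⊨φs φ∈) (lookup ⊨φs φ⇒ψ∈)
      -- Membership in `TRUE` would be too weak here, since `f □ᵒ` sends everything but top to
      -- bottom; validity makes the axiom denote top.
      justified-sound (AN _ s)       _ = ⊤≤⇒TRUE
        (Validity.⊤≤□ zorn structure (isModel⇒isL5Model 𝓛 structure isModel) (⊤≤⇒≈⊤ (valid s)))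

      -- Truth is carried for the whole list, because `MP` may refer to any earlier entry.
      derivation-sound : ∀ {φs} → Derivation 𝓛 Φ φs → All (Satisfies 𝓜 γ) φs
      derivation-sound []      = []
      derivation-sound (j ∷ d) = justified-sound j (derivation-sound d) ∷ derivation-sound d

theorem4p3 : (∀ {ℓ} → ExcludedMiddle ℓ) →
    (∀ {c ℓ₁ ℓ₂ p} → ZornsLemma c ℓ₁ ℓ₂ p) →
    ∀ (𝓛 : Logic) {ℓ} (Φ : Pred (Fm (language 𝓛)) ℓ) (φ : Fm (language 𝓛)) →
    Φ ⊢[ 𝓛 ] φ → Φ ⊩[ 𝓛 ] φ
theorem4p3 em zorn 𝓛 Φ φ (_ , d) 𝓜 γ ⊨Φ =
  head (Classical.derivation-sound em zorn 𝓛 Φ 𝓜 γ ⊨Φ d)
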